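{- There is no constant $c$ such that every graph in the class $\mathcal{R}_3$ is $c$-colorable.
   Context: All graphs are finite and simple. For a word $w$ and distinct letters $x,y$ occurring in $w$, $x$ and $y$ alternate in $w$ if deleting all letters other than copies of $x$ and $y$ yields a word of the form $xyxy\cdots$ or $yxyx\cdots$ (of even or odd length). A graph $G=(V,E)$ is word-representable if there is a word $w$ over $V$ (each vertex occurring in $w$) such that for all distinct $x,y\in V$, $x$ and $y$ alternate in $w$ iff $(x,y)\in E$. A word is $k$-uniform if each letter occurs exactly $k$ times; $G$ is $k$-word-representable if some $k$-uniform word represents it; the representation number of a word-representable graph is the least such $k$. $\mathcal{R}_3$ is the class of word-representable graphs with representation number exactly $3$. -}

module Defs where

open import Data.Fin.Base using (Fin)
open import Data.Fin.Properties using (_≟_)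
open import Data.List.Base using (List; []; _∷_; filter; length)
open import Data.List.Membership.Propositional using (_∈_)
open import Data.Nat.Base using (ℕ; zero; suc; _≤_)
open import Data.Product.Base using (∃; ∃-syntax; Σ-syntax; _×_)
open import Data.Sum.Base using (_⊎_)
open import Function.Bundles using (_⇔_)
open import Level using (0ℓ)
open import Relation.Binary.Core using (Rel)
open import Relation.Binary.Definitions using (Symmetric; Irreflexive; Decidable)
open import Relation.Binary.PropositionalEquality using (_≡_; _≢_)
open import Relation.Nullary.Decidable using (_⊎-dec_)

record Graph : Set₁ where
  field
    order  : ℕ
    Adj    : Rel (Fin order) 0ℓ
    adj?   : Decidable Adj
    symm   : Symmetric Adj
    irrefl : Irreflexive _≡_ Adj

Word : ℕ → Set
Word n = List (Fin n)

module _ {n : ℕ} where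

  restrict : Fin n → Fin n → Word n → Word n
  restrict x y = filter (λ z → (z ≟ x) ⊎-dec (z ≟ y))

  -- The word x y x y ⋯ of the given length.
  alternating : Fin n → Fin n → ℕ → Word n
  alternating x y zero    = []
  alternating x y (suc m) = x ∷ alternating y x m

  Alternate : Fin n → Fin n → Word n → Set
  Alternate x y w =
    ∃[ m ] (restrict x y w ≡ alternating x y m ⊎ restrict x y w ≡ alternating y x m)

  Uniform : ℕ → Word n → Set
  Uniform k w = ∀ v → length (filter (_≟ v) w) ≡ k

module _ (G : Graph) where
  open Graph G using (order; Adj)

  Represents : Word order → Set
  Represents w =
    (∀ v → v ∈ w) × (∀ x y → x ≢ y → Alternate x y w ⇔ Adj x y)

  WordRepresentable : Set
  WordRepresentable = ∃ Represents

  KWordRepresentable : ℕ → Set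
  KWordRepresentable k = ∃[ w ] (Uniform k w × Represents w)

  HasRepresentationNumber : ℕ → Set
  HasRepresentationNumber k =
    KWordRepresentable k × (∀ j → KWordRepresentable j → k ≤ j)

  R₃ : Set
  R₃ = WordRepresentable × HasRepresentationNumber 3

  Colorable : ℕ → Set
  Colorable c =
    Σ[ f ∈ (Fin order → Fin c) ] (∀ x y → Adj x y → f x ≢ f y)

{-# OPTIONS --safe #-}

-- The disjoint union of the triangular prism and the clique on n vertices is
-- represented by the 3-uniform word P (1 2 ⋯ n)³, where P is a 3-uniform word
-- for the prism.  Its chromatic number is at least n, and its representation
-- number is at least 3 because that of the prism is: deleting the clique letters
-- from a k-uniform representant leaves one of the prism, and an exhaustive
-- search finds none for k ≤ 2.

module Submission where

open import Defs
import Algebra.Properties.CommutativeMonoid.Sum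
open import Data.Bool.Base using (true; false)
open import Data.Fin.Base using (Fin; zero; suc; _↑ˡ_; _↑ʳ_; splitAt)
open import Data.Fin.Patterns using (0F; 1F; 2F; 3F; 4F; 5F)
open import Data.Fin.Properties
  using (_≟_; all?; suc-injective; <⇒≢; pigeonhole; ↑ʳ-injective;
         splitAt-↑ˡ; splitAt-↑ʳ; splitAt⁻¹-↑ˡ; splitAt⁻¹-↑ʳ)
open import Data.List.Base
  using (List; []; _∷_; [_]; _++_; allFin; concatMap; filter; length; map; mapMaybe; tabulate)
open import Data.List.Membership.Propositional using (_∈_)
open import Data.List.Membership.Propositional.Properties
  using (∈-allFin; ∈-concatMap⁺; ∈-filter⁺; ∈-map⁺)
import Data.List.Properties as List
open import Data.List.Relation.Unary.All using (All)
import Data.List.Relation.Unary.All as All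
open import Data.List.Relation.Unary.All.Properties using (tabulate⁺)
open import Data.List.Relation.Unary.Any using (here; there)
import Data.List.Relation.Unary.Any as Any
open import Data.Maybe.Base using (Maybe; just; nothing)
open import Data.Maybe.Properties using (just-injective)
open import Data.Nat.Base using (ℕ; zero; suc; _+_; _*_; _≤_; _<_; z≤n; s≤s)
import Data.Nat.Properties as ℕ
open import Data.Product.Base using (_×_; _,_; proj₁; proj₂; ∃-syntax; Σ-syntax)
open import Data.Sum.Base using (_⊎_; inj₁; inj₂; swap)
open import Data.Sum using (isInj₁; isInj₂)
import Data.Sum.Base as Sum
open import Function.Base using (_∘_; id; const)
open import Function.Bundles using (_⇔_; mk⇔; Equivalence)
open import Relation.Binary.PropositionalEquality
  using (_≡_; _≢_; refl; sym; trans; cong; cong₂; subst; module ≡-Reasoning)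
open import Relation.Nullary.Decidable
  using (Dec; yes; no; does; map′; from-yes; from-no; ¬?; _×-dec_; _⊎-dec_; _→-dec_)
open import Relation.Nullary.Negation.Core using (¬_; contradiction)
open import Relation.Unary using (Pred; Decidable)
open import Level using (0ℓ)

module ∑ = Algebra.Properties.CommutativeMonoid.Sum ℕ.+-0-commutativeMonoid

open Equivalence using (to; from)

-- Letter counts

count : ∀ {n} → Fin n → Word n → ℕ
count v w = length (filter (_≟ v) w)

count-++ : ∀ {n} (v : Fin n) u w → count v (u ++ w) ≡ count v u + count v w
count-++ v u w = trans (cong length (List.filter-++ (_≟ v) u w)) (List.length-++ (filter (_≟ v) u))

count-∷-≤ : ∀ {n} (v z : Fin n) w → count v w ≤ count v (z ∷ w)
count-∷-≤ v z w = ℕ.≤-trans (ℕ.m≤n+m (count v w) (count v [ z ])) (ℕ.≤-reflexive (sym (count-++ v [ z ] w)))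

count-suc : ∀ {n} (v h : Fin n) → count (suc v) [ suc h ] ≡ count v [ h ]
count-suc v h with h ≟ v
... | yes _ = refl
... | no  _ = refl

∑-count-singleton : ∀ {n} (h : Fin n) → ∑.sum (λ v → count v [ h ]) ≡ 1
∑-count-singleton {suc n} zero    = cong suc (∑.sum-replicate-zero n)
∑-count-singleton {suc n} (suc h) = trans (∑.sum-cong-≗ (λ v → count-suc v h)) (∑-count-singleton h)

∑-count : ∀ {n} (w : Word n) → ∑.sum (λ v → count v w) ≡ length w
∑-count {n} []      = ∑.sum-replicate-zero n
∑-count {n} (h ∷ w) = begin
  ∑.sum (λ v → count v (h ∷ w))                        ≡⟨ ∑.sum-cong-≗ (λ v → count-++ v [ h ] w) ⟩
  ∑.sum (λ v → count v [ h ] + count v w)              ≡⟨ ∑.∑-distrib-+ (λ v → count v [ h ]) (λ v → count v w) ⟩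
  ∑.sum (λ v → count v [ h ]) + ∑.sum (λ v → count v w) ≡⟨ cong₂ _+_ (∑-count-singleton h) (∑-count w) ⟩
  suc (length w)                                       ∎
  where open ≡-Reasoning

sum-const : ∀ n k → ∑.sum {n} (λ _ → k) ≡ n * k
sum-const zero    k = refl
sum-const (suc n) k = cong (k +_) (sum-const n k)

-- Tells at which length the exhaustive search for `k`-uniform words has to be inspected.
uniform-length : ∀ {n k} (w : Word n) → Uniform k w → length w ≡ n * k
uniform-length {n} {k} w uni = trans (sym (∑-count w)) (trans (∑.sum-cong-≗ uni) (sum-const n k))

count≡suc⇒∈ : ∀ {n k} (v : Fin n) w → count v w ≡ suc k → v ∈ w
count≡suc⇒∈ v (z ∷ w) eq with z ≟ v
... | yes z≡v = here (sym z≡v)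
... | no  _   = there (count≡suc⇒∈ v w eq)

-- Alternation

restrict-comm : ∀ {n} (x y : Fin n) w → restrict x y w ≡ restrict y x w
restrict-comm x y = List.filter-≐ (λ z → (z ≟ x) ⊎-dec (z ≟ y)) (λ z → (z ≟ y) ⊎-dec (z ≟ x)) (swap , swap)

alternate-sym : ∀ {n} (x y : Fin n) w → Alternate x y w → Alternate y x w
alternate-sym x y w (m , alt) = m , swap (subst (λ r → r ≡ _ ⊎ r ≡ _) (restrict-comm x y w) alt)

-- The existential over `m` is decidable because `m` is forced to be the length of `r`: one reads
-- `r` letter by letter, exchanging `x` and `y` at each step.
alternating? : ∀ {n} (x y : Fin n) r → Dec (∃[ m ] r ≡ alternating x y m)
alternating? x y []      = yes (0 , refl)
alternating? x y (z ∷ r) = map′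
  (λ { (refl , m , eq) → suc m , cong (x ∷_) eq })
  (λ { (zero , ()) ; (suc m , refl) → refl , m , refl })
  (z ≟ x ×-dec alternating? y x r)

-- Taking the restricted word as an argument lets the evaluator compute it once.
eitherAlternating? : ∀ {n} (x y : Fin n) r → Dec (∃[ m ] (r ≡ alternating x y m ⊎ r ≡ alternating y x m))
eitherAlternating? x y r = map′
  (λ { (inj₁ (m , eq)) → m , inj₁ eq ; (inj₂ (m , eq)) → m , inj₂ eq })
  (λ { (m , inj₁ eq) → inj₁ (m , eq) ; (m , inj₂ eq) → inj₂ (m , eq) })
  (alternating? x y r ⊎-dec alternating? y x r)

alternate? : ∀ {n} (x y : Fin n) w → Dec (Alternate x y w)
alternate? x y w = eitherAlternating? x y (restrict x y w)

alternating-tail : ∀ {n} (x y z : Fin n) r m → z ∷ r ≡ alternating x y m → ∃[ m′ ] r ≡ alternating y x m′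
alternating-tail x y z r (suc m) refl = m , refl

-- If the deleted letter is `x` or `y`, what remains alternates with the two roles exchanged. This
-- lets a failed edge condition on a suffix rule out every word ending in it.
alternate-tail : ∀ {n} (x y z : Fin n) w → Alternate x y (z ∷ w) → Alternate x y w
alternate-tail x y z w (m , alt) with does ((z ≟ x) ⊎-dec (z ≟ y)) | alt
... | false | alt′    = m , alt′
... | true  | inj₁ eq = let m′ , eq′ = alternating-tail x y z (restrict x y w) m eq in m′ , inj₂ eq′
... | true  | inj₂ eq = let m′ , eq′ = alternating-tail y x z (restrict x y w) m eq in m′ , inj₁ eq′

-- Equality fails when `x` and `y` coincide, since the right-hand side then counts each occurrence
-- twice.
length-restrict-≤ : ∀ {n} (x y : Fin n) w → length (restrict x y w) ≤ count x w + count y w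
length-restrict-≤ x y []      = z≤n
length-restrict-≤ x y (z ∷ w) with z ≟ x | z ≟ y
... | yes _ | yes _ = s≤s (ℕ.≤-trans (length-restrict-≤ x y w) (ℕ.+-monoʳ-≤ (count x w) (ℕ.n≤1+n _)))
... | yes _ | no  _ = s≤s (length-restrict-≤ x y w)
... | no  _ | yes _ = ℕ.≤-trans (s≤s (length-restrict-≤ x y w)) (ℕ.≤-reflexive (sym (ℕ.+-suc _ _)))
... | no  _ | no  _ = length-restrict-≤ x y w

-- Deleting the letters outside the image of an injection

filter-map : ∀ {m n} {P : Pred (Fin n) 0ℓ} (P? : Decidable P) (f : Fin m → Fin n) w →
             filter P? (map f w) ≡ map f (filter (P? ∘ f) w)
filter-map P? f []      = refl
filter-map P? f (i ∷ w) with does (P? (f i))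
... | true  = cong (f i ∷_) (filter-map P? f w)
... | false = filter-map P? f w

map-alternating : ∀ {m n} (f : Fin m → Fin n) x y k →
                  map f (alternating x y k) ≡ alternating (f x) (f y) k
map-alternating f x y zero    = refl
map-alternating f x y (suc k) = cong (f x ∷_) (map-alternating f y x k)

-- The two hypotheses say that `g` is the inverse of `f`, defined exactly on the image of `f`. Hence
-- `mapMaybe g` deletes the foreign letters and renames the others in one pass.
module Projection {m n : ℕ} (f : Fin m → Fin n) (g : Fin n → Maybe (Fin m))
                  (g∘f : ∀ i → g (f i) ≡ just i) (f∘g : ∀ v i → g v ≡ just i → f i ≡ v) where

  f-injective : ∀ {i j} → f i ≡ f j → i ≡ j
  f-injective {i} {j} eq = just-injective (trans (sym (g∘f i)) (trans (cong g eq) (g∘f j)))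

  -- A filter that accepts only letters in the image of `f` cannot see the deletion. Counts and
  -- restrictions are both such filters.
  filter-mapMaybe : {P : Pred (Fin n) 0ℓ} (P? : Decidable P) → (∀ v → P v → ∃[ i ] g v ≡ just i) → ∀ w →
                    filter P? w ≡ map f (filter (P? ∘ f) (mapMaybe g w))
  filter-mapMaybe P? P⇒im []      = refl
  filter-mapMaybe P? P⇒im (v ∷ w) with g v in eq
  ... | nothing = trans
    (List.filter-reject P? λ pv → contradiction (trans (sym eq) (proj₂ (P⇒im v pv))) λ ())
    (filter-mapMaybe P? P⇒im w)
  ... | just i with refl ← f∘g v i eq with does (P? (f i))
  ...   | true  = cong (f i ∷_) (filter-mapMaybe P? P⇒im w)
  ...   | false = filter-mapMaybe P? P⇒im w

  count-mapMaybe : ∀ i w → count (f i) w ≡ count i (mapMaybe g w)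
  count-mapMaybe i w = begin
    count (f i) w                                      ≡⟨ cong length (filter-mapMaybe (_≟ f i) (λ { _ refl → i , g∘f i }) w) ⟩
    length (map f (filter ((_≟ f i) ∘ f) (mapMaybe g w))) ≡⟨ List.length-map f (filter ((_≟ f i) ∘ f) (mapMaybe g w)) ⟩
    length (filter ((_≟ f i) ∘ f) (mapMaybe g w))      ≡⟨ cong length (List.filter-≐ ((_≟ f i) ∘ f) (_≟ i) (f-injective , cong f) (mapMaybe g w)) ⟩
    count i (mapMaybe g w)                             ∎
    where open ≡-Reasoning

  restrict-mapMaybe : ∀ x y w → restrict (f x) (f y) w ≡ map f (restrict x y (mapMaybe g w))
  restrict-mapMaybe x y w = trans
    (filter-mapMaybe (λ v → (v ≟ f x) ⊎-dec (v ≟ f y))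
      (λ { _ (inj₁ refl) → x , g∘f x ; _ (inj₂ refl) → y , g∘f y }) w)
    (cong (map f) (List.filter-≐ _ (λ v → (v ≟ x) ⊎-dec (v ≟ y))
      (Sum.map f-injective f-injective , Sum.map (cong f) (cong f)) (mapMaybe g w)))

  -- The two restricted words differ only by the renaming `map f`, which is injective and carries
  -- alternating words to alternating words.
  alternate-mapMaybe : ∀ x y w → Alternate (f x) (f y) w ⇔ Alternate x y (mapMaybe g w)
  alternate-mapMaybe x y w = mk⇔
    (λ (k , alt) → k , Sum.map (reflects x y k) (reflects y x k) alt)
    (λ (k , alt) → k , Sum.map (preserves x y k) (preserves y x k) alt)
    where
    r = restrict x y (mapMaybe g w)
    r↑ = restrict (f x) (f y) w
    reflects : ∀ a b k → r↑ ≡ alternating (f a) (f b) k → r ≡ alternating a b k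
    reflects a b k eq = List.map-injective f-injective
      (trans (sym (restrict-mapMaybe x y w)) (trans eq (sym (map-alternating f a b k))))
    preserves : ∀ a b k → r ≡ alternating a b k → r↑ ≡ alternating (f a) (f b) k
    preserves a b k eq = trans (restrict-mapMaybe x y w) (trans (cong (map f) eq) (map-alternating f a b k))

-- The prism

prismWord : Word 6
prismWord = 5F ∷ 2F ∷ 4F ∷ 1F ∷ 3F ∷ 5F ∷ 4F ∷ 0F ∷ 3F ∷ 2F ∷ 5F ∷ 1F ∷ 4F ∷ 0F ∷ 3F ∷ 2F ∷ 1F ∷ 0F ∷ []

-- The triangles 0 1 2 and 3 4 5 are joined by the matching of `i` with `i + 3`. The two lists
-- together contain each of the 15 pairs once.
edges nonEdges : List (Fin 6 × Fin 6)
edges = (0F , 1F) ∷ (1F , 2F) ∷ (0F , 2F) ∷ (3F , 4F) ∷ (4F , 5F) ∷ (3F , 5F)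
      ∷ (0F , 3F) ∷ (1F , 4F) ∷ (2F , 5F) ∷ []
nonEdges = (0F , 4F) ∷ (0F , 5F) ∷ (1F , 3F) ∷ (1F , 5F) ∷ (2F , 3F) ∷ (2F , 4F) ∷ []

edges-alternate : All (λ (x , y) → x ≢ y × Alternate x y prismWord) edges
edges-alternate = from-yes (All.all? (λ (x , y) → ¬? (x ≟ y) ×-dec alternate? x y prismWord) edges)

nonEdges-¬alternate : All (λ (x , y) → x ≢ y × ¬ Alternate x y prismWord) nonEdges
nonEdges-¬alternate = from-yes (All.all? (λ (x , y) → ¬? (x ≟ y) ×-dec ¬? (alternate? x y prismWord)) nonEdges)

prismWord-uniform : Uniform 3 prismWord
prismWord-uniform = from-yes (all? (λ v → count v prismWord ℕ.≟ 3))

-- The search builds words from right to left.  A non-edge can refute a suffix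
-- only once all 2 k copies of its two letters have been placed.
Exhausted : ℕ → Fin 6 × Fin 6 → Word 6 → Set
Exhausted k (x , y) w = length (restrict x y w) ≡ 2 * k × Alternate x y w

exhausted? : ∀ k e w → Dec (Exhausted k e w)
exhausted? k (x , y) w = (length (restrict x y w) ℕ.≟ 2 * k) ×-dec alternate? x y w

-- Necessary conditions on a suffix of a `k`-uniform word for the prism, each chosen so that it
-- passes to shorter suffixes.
Plausible : ℕ → Word 6 → Set
Plausible k w =
    (∀ v → count v w ≤ k)
  × All (λ (x , y) → Alternate x y w) edges
  × All (λ e → ¬ Exhausted k e w) nonEdges

-- Once all `2 * k` copies of `x` and `y` are placed, the bound forbids prepending another, and any
-- other letter leaves the restriction unchanged.
exhausted-∷ : ∀ k e z w → (∀ v → count v (z ∷ w) ≤ k) → Exhausted k e w → Exhausted k e (z ∷ w)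
exhausted-∷ k (x , y) z w bound (len , alt)
  with does ((z ≟ x) ⊎-dec (z ≟ y)) | length-restrict-≤ x y (z ∷ w)
... | false | _  = len , alt
-- Here `le` bounds the successor of `length (restrict x y w)` by two counts of at most `k` each,
-- while that length is already `2 * k`.
... | true  | le = contradiction
  (ℕ.≤-trans le (ℕ.≤-trans (ℕ.+-mono-≤ (bound x) (bound y))
    (ℕ.≤-reflexive (trans (cong (k +_) (sym (ℕ.+-identityʳ k))) (sym len)))))
  ℕ.1+n≰n

plausible-tail : ∀ k z w → Plausible k (z ∷ w) → Plausible k w
plausible-tail k z w (bound , es , ns) =
    (λ v → ℕ.≤-trans (count-∷-≤ v z w) (bound v))
  , All.map (λ {(x , y)} → alternate-tail x y z w) es
  , All.map (λ {e} ¬ex → ¬ex ∘ exhausted-∷ k e z w bound) ns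

Incident : Fin 6 → Fin 6 × Fin 6 → Set
Incident v (x , y) = v ≡ x ⊎ v ≡ y

incident? : ∀ v e → Dec (Incident v e)
incident? v (x , y) = (v ≟ x) ⊎-dec (v ≟ y)

-- When v is prepended, only the conditions involving v need to be tested again.
PlausibleAt : ℕ → Fin 6 → Word 6 → Set
PlausibleAt k v w =
    count v w ≤ k
  × All (λ e → Incident v e → Alternate (proj₁ e) (proj₂ e) w) edges
  × All (λ e → Incident v e → ¬ Exhausted k e w) nonEdges

plausibleAt? : ∀ k v w → Dec (PlausibleAt k v w)
plausibleAt? k v w =
        (count v w ℕ.≤? k)
  ×-dec All.all? (λ e → incident? v e →-dec alternate? (proj₁ e) (proj₂ e) w) edges
  ×-dec All.all? (λ e → incident? v e →-dec ¬? (exhausted? k e w)) nonEdges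

plausible⇒at : ∀ k v w → Plausible k w → PlausibleAt k v w
plausible⇒at k v w (bound , es , ns) = bound v , All.map const es , All.map const ns

extensions : ℕ → Word 6 → List (Word 6)
extensions k w = map (_∷ w) (filter (λ v → plausibleAt? k v (v ∷ w)) (allFin 6))

plausibleWords : ℕ → ℕ → List (Word 6)
plausibleWords k zero    = [ [] ]
plausibleWords k (suc l) = concatMap (extensions k) (plausibleWords k l)

-- Completeness of the search: the tail of a plausible word is plausible, hence listed at the
-- previous level, and the head passes the weaker test `PlausibleAt`.
plausible⇒∈ : ∀ k w → Plausible k w → w ∈ plausibleWords k (length w)
plausible⇒∈ k []      _ = here refl
plausible⇒∈ k (v ∷ w) p = ∈-concatMap⁺ (extensions k) (Any.map
  (λ { refl → ∈-map⁺ (_∷ w) (∈-filter⁺ (λ v → plausibleAt? k v (v ∷ w)) (∈-allFin v) (plausible⇒at k v (v ∷ w) p)) })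
  (plausible⇒∈ k w (plausible-tail k v w p)))

-- The type checker runs the search. Here and below, the lengths 6 and 12 are `6 * k`, the length of
-- a `k`-uniform word on six letters.
plausibleWords-1-6 : plausibleWords 1 6 ≡ []
plausibleWords-1-6 = refl

plausibleWords-2-12 : plausibleWords 2 12 ≡ []
plausibleWords-2-12 = refl

-- Representing the prism is phrased as having the same alternating pairs as `prismWord`; the two
-- checked lists turn this into conditions on `w` alone.
uniform⇒plausible : ∀ k w → Uniform k w →
  (∀ x y → x ≢ y → Alternate x y w ⇔ Alternate x y prismWord) → Plausible k w
uniform⇒plausible k w uni same =
    (λ v → ℕ.≤-reflexive (uni v))
  , All.map (λ { {x , y} (x≢y , alt) → from (same x y x≢y) alt }) edges-alternate
  , All.map (λ { {x , y} (x≢y , ¬alt) (_ , alt) → ¬alt (to (same x y x≢y) alt) }) nonEdges-¬alternate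

¬plausible : ∀ k l → plausibleWords k l ≡ [] → ∀ w → length w ≡ l → ¬ Plausible k w
¬plausible k l none w len p =
  contradiction (subst (w ∈_) (trans (cong (plausibleWords k) len) none) (plausible⇒∈ k w p)) λ ()

prism-uniform⇒3≤ : ∀ k w → Uniform k w →
  (∀ x y → x ≢ y → Alternate x y w ⇔ Alternate x y prismWord) → 3 ≤ k
-- In the empty word every pair alternates, but the non-edge 0 4 does not alternate in `prismWord`.
prism-uniform⇒3≤ 0 [] _ same =
  contradiction (to (same 0F 4F λ ()) (0 , inj₁ refl)) (from-no (alternate? 0F 4F prismWord))
prism-uniform⇒3≤ 0 (z ∷ w) uni _ = contradiction (uniform-length (z ∷ w) uni) λ ()
prism-uniform⇒3≤ 1 w uni same =
  contradiction (uniform⇒plausible 1 w uni same) (¬plausible 1 6 plausibleWords-1-6 w (uniform-length w uni))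
prism-uniform⇒3≤ 2 w uni same =
  contradiction (uniform⇒plausible 2 w uni same) (¬plausible 2 12 plausibleWords-2-12 w (uniform-length w uni))
prism-uniform⇒3≤ (suc (suc (suc k))) w uni same = s≤s (s≤s (s≤s z≤n))

-- The clique

tabulate-suc : ∀ n → tabulate {n = n} Fin.suc ≡ map Fin.suc (allFin n)
tabulate-suc n = sym (List.map-tabulate id Fin.suc)

filter-allFin : ∀ {n} (i : Fin n) → filter (_≟ i) (allFin n) ≡ [ i ]
filter-allFin {suc n} zero    = cong (zero ∷_) (List.filter-none (_≟ zero) {tabulate suc} (tabulate⁺ {f = suc} λ _ ()))
filter-allFin {suc n} (suc i) = begin
  filter (_≟ suc i) (tabulate suc)               ≡⟨ cong (filter (_≟ suc i)) (tabulate-suc n) ⟩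
  filter (_≟ suc i) (map suc (allFin n))         ≡⟨ filter-map (_≟ suc i) suc (allFin n) ⟩
  map suc (filter ((_≟ suc i) ∘ suc) (allFin n)) ≡⟨ cong (map suc) (List.filter-≐ ((_≟ suc i) ∘ suc) (_≟ i) (suc-injective , cong suc) (allFin n)) ⟩
  map suc (filter (_≟ i) (allFin n))             ≡⟨ cong (map suc) (filter-allFin i) ⟩
  [ suc i ]                                      ∎
  where open ≡-Reasoning

-- `P` is the condition pulled back along `suc`. It is left abstract because it tests for one letter
-- when `x` is `zero` and for two when both letters are successors.
restrict-tabulate-suc : ∀ {n} {P : Pred (Fin n) 0ℓ} (P? : Decidable P) (x y : Fin (suc n)) →
  (∀ {i} → suc i ≡ x ⊎ suc i ≡ y → P i) → (∀ {i} → P i → suc i ≡ x ⊎ suc i ≡ y) →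
  restrict x y (tabulate suc) ≡ map suc (filter P? (allFin n))
restrict-tabulate-suc {n} P? x y ⇒P P⇒ = begin
  restrict x y (tabulate suc)                   ≡⟨ cong (restrict x y) (tabulate-suc n) ⟩
  restrict x y (map suc (allFin n))             ≡⟨ filter-map xy? suc (allFin n) ⟩
  map suc (filter (xy? ∘ suc) (allFin n))       ≡⟨ cong (map suc) (List.filter-≐ (xy? ∘ suc) P? (⇒P , P⇒) (allFin n)) ⟩
  map suc (filter P? (allFin n))                ∎
  where
  open ≡-Reasoning
  xy? : Decidable (λ z → z ≡ x ⊎ z ≡ y)
  xy? z = (z ≟ x) ⊎-dec (z ≟ y)

restrict-zero-allFin : ∀ {n} (j : Fin n) → restrict zero (suc j) (allFin (suc n)) ≡ zero ∷ suc j ∷ []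
restrict-zero-allFin j = cong (zero ∷_) (trans
  (restrict-tabulate-suc (_≟ j) zero (suc j) (λ { (inj₂ eq) → suc-injective eq }) (inj₂ ∘ cong suc))
  (cong (map suc) (filter-allFin j)))

restrict-allFin : ∀ {n} (i j : Fin n) → i ≢ j →
  restrict i j (allFin n) ≡ i ∷ j ∷ [] ⊎ restrict i j (allFin n) ≡ j ∷ i ∷ []
restrict-allFin zero    zero    i≢j = contradiction refl i≢j
restrict-allFin zero    (suc j) _   = inj₁ (restrict-zero-allFin j)
restrict-allFin (suc i) zero    _   = inj₂ (trans (restrict-comm (suc i) zero (allFin _)) (restrict-zero-allFin i))
restrict-allFin (suc i) (suc j) i≢j = Sum.map lift lift (restrict-allFin i j (i≢j ∘ cong suc))
  where
  lift : ∀ {r} → restrict i j (allFin _) ≡ r → restrict (suc i) (suc j) (allFin _) ≡ map suc r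
  lift eq = trans
    (restrict-tabulate-suc (λ z → (z ≟ i) ⊎-dec (z ≟ j)) (suc i) (suc j)
      (Sum.map suc-injective suc-injective) (Sum.map (cong suc) (cong suc)))
    (cong (map suc) eq)

-- Three copies match the three occurrences of each letter in `prismWord`, so that the concatenation
-- is again 3-uniform.
cliqueWord : ∀ n → Word n
cliqueWord n = allFin n ++ allFin n ++ allFin n

cliqueWord-uniform : ∀ n → Uniform 3 (cliqueWord n)
cliqueWord-uniform n v
  rewrite count-++ v (allFin n) (allFin n ++ allFin n) | count-++ v (allFin n) (allFin n)
        | filter-allFin v = refl

-- Every copy of `allFin n` contributes `i` and `j` once each, always in the same order; the three
-- copies give an alternating word of length 6.
cliqueWord-alternate : ∀ {n} (i j : Fin n) → i ≢ j → Alternate i j (cliqueWord n)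
cliqueWord-alternate {n} i j i≢j = 6 , Sum.map triple triple (restrict-allFin i j i≢j)
  where
  triple : ∀ {r} → restrict i j (allFin n) ≡ r → restrict i j (cliqueWord n) ≡ r ++ r ++ r
  triple refl = trans (List.filter-++ _ (allFin n) (allFin n ++ allFin n))
    (cong (restrict i j (allFin n) ++_) (List.filter-++ _ (allFin n) (allFin n)))

-- The disjoint union

-- Reading adjacency off the word makes the word represent the graph by construction. The conjunct
-- `x ≢ y` excludes loops, as every letter satisfies `Alternate` with itself.
wordGraph : ∀ {n} → Word n → Graph
wordGraph {n} w = record
  { order  = n
  ; Adj    = λ x y → x ≢ y × Alternate x y w
  ; adj?   = λ x y → ¬? (x ≟ y) ×-dec alternate? x y w
  ; symm   = λ { {x} {y} (x≢y , alt) → x≢y ∘ sym , alternate-sym x y w alt }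
  ; irrefl = λ x≡y (x≢y , _) → x≢y x≡y
  }

wordGraph-represents : ∀ {n} (w : Word n) → (∀ v → v ∈ w) → Represents (wordGraph w) w
wordGraph-represents w ∈w = ∈w , λ x y x≢y → mk⇔ (x≢y ,_) proj₂

module _ (n : ℕ) where

  toPrism : Fin (6 + n) → Maybe (Fin 6)
  toPrism = isInj₁ ∘ splitAt 6

  toClique : Fin (6 + n) → Maybe (Fin n)
  toClique = isInj₂ ∘ splitAt 6

  toPrism-↑ˡ : ∀ i → toPrism (i ↑ˡ n) ≡ just i
  toPrism-↑ˡ i = cong isInj₁ (splitAt-↑ˡ 6 i n)

  toPrism-↑ʳ : ∀ j → toPrism (6 ↑ʳ j) ≡ nothing
  toPrism-↑ʳ j = cong isInj₁ (splitAt-↑ʳ 6 n j)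

  toClique-↑ˡ : ∀ i → toClique (i ↑ˡ n) ≡ nothing
  toClique-↑ˡ i = cong isInj₂ (splitAt-↑ˡ 6 i n)

  toClique-↑ʳ : ∀ j → toClique (6 ↑ʳ j) ≡ just j
  toClique-↑ʳ j = cong isInj₂ (splitAt-↑ʳ 6 n j)

  toPrism⁻¹ : ∀ v i → toPrism v ≡ just i → i ↑ˡ n ≡ v
  toPrism⁻¹ v i eq with splitAt 6 v in split | eq
  ... | inj₁ i | refl = splitAt⁻¹-↑ˡ {6} {i = v} split

  toClique⁻¹ : ∀ v j → toClique v ≡ just j → 6 ↑ʳ j ≡ v
  toClique⁻¹ v j eq with splitAt 6 v in split | eq
  ... | inj₂ j | refl = splitAt⁻¹-↑ʳ {6} {i = v} split

  module Prism  = Projection (_↑ˡ n) toPrism toPrism-↑ˡ toPrism⁻¹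
  module Clique = Projection (6 ↑ʳ_) toClique toClique-↑ʳ toClique⁻¹

  unionWord : Word (6 + n)
  unionWord = map (_↑ˡ n) prismWord ++ map (6 ↑ʳ_) (cliqueWord n)

  unionWord-prism : mapMaybe toPrism unionWord ≡ prismWord
  unionWord-prism = trans (List.mapMaybe-++ toPrism (map (_↑ˡ n) prismWord) (map (6 ↑ʳ_) (cliqueWord n)))
    (trans (cong₂ _++_ (List.mapMaybe-map-retract {proj = toPrism} {_↑ˡ n} toPrism-↑ˡ prismWord)
                       (List.mapMaybe-map-none {proj = toPrism} {6 ↑ʳ_} toPrism-↑ʳ (cliqueWord n)))
           (List.++-identityʳ prismWord))

  unionWord-clique : mapMaybe toClique unionWord ≡ cliqueWord n
  unionWord-clique = trans (List.mapMaybe-++ toClique (map (_↑ˡ n) prismWord) (map (6 ↑ʳ_) (cliqueWord n)))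
    (cong₂ _++_ (List.mapMaybe-map-none {proj = toClique} {_↑ˡ n} toClique-↑ˡ prismWord)
                (List.mapMaybe-map-retract {proj = toClique} {6 ↑ʳ_} toClique-↑ʳ (cliqueWord n)))

  -- Each letter is counted in the projection to its own block, which is `prismWord` or
  -- `cliqueWord n`.
  unionWord-uniform : Uniform 3 unionWord
  unionWord-uniform v with splitAt 6 v in eq
  ... | inj₁ i = subst (λ v → count v unionWord ≡ 3) (splitAt⁻¹-↑ˡ {6} {i = v} eq)
    (trans (Prism.count-mapMaybe i unionWord) (trans (cong (count i) unionWord-prism) (prismWord-uniform i)))
  ... | inj₂ j = subst (λ v → count v unionWord ≡ 3) (splitAt⁻¹-↑ʳ {6} {i = v} eq)
    (trans (Clique.count-mapMaybe j unionWord) (trans (cong (count j) unionWord-clique) (cliqueWord-uniform n j)))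

  unionGraph : Graph
  unionGraph = wordGraph unionWord

  unionWord-represents : Represents unionGraph unionWord
  unionWord-represents = wordGraph-represents unionWord
    (λ v → count≡suc⇒∈ v unionWord (unionWord-uniform v))

  -- Both `w` and `unionWord` represent the graph, so they have the same alternating pairs. This
  -- survives projection to the prism letters, where `unionWord` becomes `prismWord`, and so does
  -- uniformity of `w`.
  unionGraph-uniform⇒3≤ : ∀ k → KWordRepresentable unionGraph k → 3 ≤ k
  unionGraph-uniform⇒3≤ k (w , uni , _ , rep) = prism-uniform⇒3≤ k (mapMaybe toPrism w)
    (λ i → trans (sym (Prism.count-mapMaybe i w)) (uni (i ↑ˡ n)))
    (λ x y x≢y →
      let x↑≢y↑ = x≢y ∘ Prism.f-injective in mk⇔
        (λ alt → subst (Alternate x y) unionWord-prism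
          (to (Prism.alternate-mapMaybe x y unionWord)
            (proj₂ (to (rep (x ↑ˡ n) (y ↑ˡ n) x↑≢y↑) (from (Prism.alternate-mapMaybe x y w) alt)))))
        (λ alt → to (Prism.alternate-mapMaybe x y w)
          (from (rep (x ↑ˡ n) (y ↑ˡ n) x↑≢y↑) (x↑≢y↑ ,
            from (Prism.alternate-mapMaybe x y unionWord) (subst (Alternate x y) (sym unionWord-prism) alt)))))

  unionGraph-R₃ : R₃ unionGraph
  unionGraph-R₃ =
      (unionWord , unionWord-represents)
    , (unionWord , unionWord-uniform , unionWord-represents)
    , unionGraph-uniform⇒3≤

  unionGraph-clique : ∀ i j → i ≢ j → Graph.Adj unionGraph (6 ↑ʳ i) (6 ↑ʳ j)
  unionGraph-clique i j i≢j = i≢j ∘ ↑ʳ-injective 6 i j ,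
    from (Clique.alternate-mapMaybe i j unionWord)
      (subst (Alternate i j) (sym unionWord-clique) (cliqueWord-alternate i j i≢j))

  unionGraph-¬colorable : ∀ {c} → c < n → ¬ Colorable unionGraph c
  unionGraph-¬colorable c<n (f , proper) with pigeonhole c<n (f ∘ (6 ↑ʳ_))
  ... | i , j , i<j , same = proper (6 ↑ʳ i) (6 ↑ʳ j) (unionGraph-clique i j (<⇒≢ i<j)) same

theorem18 : ¬ (Σ[ c ∈ ℕ ] (∀ (G : Graph) → R₃ G → Colorable G c))
-- A clique with one vertex more than there are colors defeats `c`.
theorem18 (c , color) = unionGraph-¬colorable (suc c) ℕ.≤-refl
  (color (unionGraph (suc c)) (unionGraph-R₃ (suc c)))
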